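{- For every prime power $q=p^r$ with $p\neq 2$ one has $\mathcal{I}(\mathbb{F}_q,2)=q$.
   Context: For points $u=(u_1,u_2)$, $v=(v_1,v_2)$ in $\mathbb{F}_q^2$ the squared distance is $d^2(u,v)=(u_1-v_1)^2+(u_2-v_2)^2\in\mathbb{F}_q$. Two points are at integral distance if $d^2(u,v)=t^2$ for some $t\in\mathbb{F}_q$ (so $0$ is allowed). An integral point set in $\mathbb{F}_q^2$ is a set of points that are pairwise at integral distance. $\mathcal{I}(\mathbb{F}_q,2)$ denotes the maximum cardinality of an integral point set in $\mathbb{F}_q^2$. -}

module Defs where

open import Algebra.Apartness.Bundles using (HeytingField)
open import Data.Fin.Base using (Fin)
open import Data.Nat.Base using (ℕ; _≤_)
open import Data.Product.Base using (Σ; ∃-syntax; _×_; _,_; proj₁)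
open import Data.Product.Relation.Binary.Pointwise.NonDependent using (×-setoid)
open import Function.Bundles using (Inverse)
open import Level using (Level; _⊔_; suc)
open import Relation.Binary.Bundles using (Setoid)
import Relation.Binary.Construct.On as On
open import Relation.Binary.Definitions using (_Respects_)
import Relation.Binary.PropositionalEquality.Properties as ≡
open import Relation.Unary using (Pred; _∈_)

HasCardinality : {a ℓ : Level} → Setoid a ℓ → ℕ → Set (a ⊔ ℓ)
HasCardinality S n = Inverse S (≡.setoid (Fin n))

-- Elements of the subset are identified when their underlying points are
-- equal, whatever the membership proofs.
subsetSetoid : {a ℓ p : Level} (S : Setoid a ℓ) →
               Pred (Setoid.Carrier S) p → Setoid (a ⊔ p) ℓ
subsetSetoid S P = On.setoid {B = Σ (Setoid.Carrier S) P} S proj₁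

IsMaximum : {ℓ : Level} → Pred ℕ ℓ → Pred ℕ ℓ
IsMaximum P m = m ∈ P × (∀ n → n ∈ P → n ≤ m)

-- For a finite carrier the apartness of a Heyting field is the negation of
-- its equality, so a finite Heyting field is a finite field in the usual sense
-- (0# ≉ 1# included: otherwise 0# - 0# would be invertible, giving 0# # 0#).
module Plane {c ℓ₁ ℓ₂ : Level} (F : HeytingField c ℓ₁ ℓ₂) where

  open HeytingField F

  infix 9 _²

  _² : Carrier → Carrier
  x ² = x * x

  planeSetoid : Setoid c ℓ₁
  planeSetoid = ×-setoid setoid setoid

  Point : Set c
  Point = Setoid.Carrier planeSetoid

  d² : Point → Point → Carrier
  d² (u₁ , u₂) (v₁ , v₂) = (u₁ - v₁) ² + (u₂ - v₂) ²

  AtIntegralDistance : Point → Point → Set (c ⊔ ℓ₁)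
  AtIntegralDistance u v = ∃[ t ] d² u v ≈ t ²

  -- The case u = v is harmless in `integral`, since d² u u ≈ 0# ².
  record IntegralPointSet (ℓ : Level) : Set (c ⊔ ℓ₁ ⊔ suc ℓ) where
    field
      points   : Pred Point ℓ
      respects : points Respects (Setoid._≈_ planeSetoid)
      integral : ∀ {u v} → u ∈ points → v ∈ points → AtIntegralDistance u v

  IntegralCardinality : (ℓ : Level) → Pred ℕ (c ⊔ ℓ₁ ⊔ suc ℓ)
  IntegralCardinality ℓ n =
    ∃[ A ] HasCardinality (subsetSetoid planeSetoid (IntegralPointSet.points {ℓ} A)) n

-- `MaximumIntegralCardinality F ℓ m` says 𝓘(F, 2) = m,
-- where point sets are predicates of level ℓ.
MaximumIntegralCardinality : {c ℓ₁ ℓ₂ : Level} → HeytingField c ℓ₁ ℓ₂ →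
                             (ℓ : Level) → Pred ℕ (c ⊔ ℓ₁ ⊔ suc ℓ)
MaximumIntegralCardinality F ℓ = IsMaximum (Plane.IntegralCardinality F ℓ)

{-# OPTIONS --safe #-}
-- Lower bound: the points of the x-axis are pairwise at integral distance.
--
-- Upper bound: suppose a² + b² is not a square.  Two distinct points on a line
-- of direction (a , b) have squared distance λ²(a² + b²) with λ ≠ 0, which is
-- not a square, so an integral point set meets each of the q parallel lines
-- a y - b x = const at most once.  Such a and b exist: otherwise the squares
-- are closed under addition, hence under negation (- s is a multiple of s, as
-- q s = 0), so that every z = 2x + 1 = (x + 1)² - x² is a square (2 is
-- invertible because q is odd).  But squaring is not onto a finite set, since
-- it identifies 1 and -1.
module Submission where

open import Defs
open import Algebra.Apartness.Bundles using (HeytingField)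
open import Algebra.Bundles using (CommutativeRing)
import Algebra.Apartness.Properties.HeytingCommutativeRing as HeytingCommutativeRingProperties
import Algebra.Properties.CommutativeMonoid.Sum as Sum
import Algebra.Properties.Group as GroupProperties
import Algebra.Properties.Monoid.Mult as Mult
import Algebra.Properties.Ring as RingProperties
import Algebra.Solver.Ring.NaturalCoefficients.Default as NaturalSolver
open import Data.Fin.Base using (Fin; zero; suc)
import Data.Fin.Permutation as Permutation
import Data.Fin.Properties as Fin
open import Data.Nat.Base as ℕ using (ℕ; _^_; _≥_; _≤_; zero; suc)
open import Data.Nat.Divisibility using (_∤_; ∣1⇒≡1; m%n≡0⇒n∣m)
open import Data.Nat.DivMod using (_%_; _/_; m%n<n; m≡m%n+[m/n]*n)
open import Data.Nat.Primality using (Prime; prime[2]; euclidsLemma; prime⇒irreducible)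
open import Data.Nat.Properties using (1+n≰n)
open import Data.Product.Base using (∃-syntax; _×_; _,_; proj₁; proj₂)
open import Data.Sum.Base using (inj₁; inj₂)
open import Function.Base using (_∘_)
open import Function.Bundles using (Inverse; Injection)
open import Function.Definitions using (Injective)
open import Function.Properties.Inverse using (Inverse⇒Injection) renaming (sym to Inverse-sym)
open import Level using (Level; Lift; lift)
open import Relation.Binary.Bundles using (Setoid)
open import Relation.Binary.Definitions as Binary using (_Respects_)
open import Relation.Binary.PropositionalEquality as ≡ using (_≡_; _≢_)
import Relation.Binary.Reasoning.Setoid as SetoidReasoning
open import Relation.Nullary.Decidable
  using (Dec; yes; no; ¬?; map′; decidable-stable; via-injection)
open import Relation.Nullary.Negation using (¬_; contradiction)
open import Relation.Unary using (Pred; Decidable)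

-- Powers of an odd prime are odd.

2∤p^r : ∀ {p} r → Prime p → p ≢ 2 → 2 ∤ p ^ r
2∤p^r zero pr p≢2 2∣1 = contradiction (∣1⇒≡1 2∣1) λ ()
2∤p^r {p} (suc r) pr p≢2 2∣p^r with euclidsLemma p (p ^ r) prime[2] 2∣p^r
... | inj₂ 2∣ = 2∤p^r r pr p≢2 2∣
... | inj₁ 2∣p with prime⇒irreducible pr 2∣p
-- The other alternative of irreducibility, `2 ≡ 1`, is refuted by coverage.
...   | inj₂ 2≡p = p≢2 (≡.sym 2≡p)

2∤n⇒n≡1+m*2 : ∀ {n} → 2 ∤ n → ∃[ m ] n ≡ suc (m ℕ.* 2)
2∤n⇒n≡1+m*2 {n} 2∤n with n % 2 in eq | m%n<n n 2 | m≡m%n+[m/n]*n n 2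
... | 0 | _ | _ = contradiction (m%n≡0⇒n∣m n 2 eq) 2∤n
... | 1 | _ | n≡ = n / 2 , n≡
... | suc (suc _) | ℕ.s≤s (ℕ.s≤s ()) | _

-- Search and counting in finite setoids.

module Finite {a ℓ n} (S : Setoid a ℓ) (finite : HasCardinality S n) where
  open Setoid S
  open Inverse finite

  _≟_ : Binary.Decidable _≈_
  _≟_ = via-injection (Inverse⇒Injection finite) Fin._≟_

  -- Only the representatives `from i` are searched; `resp` carries an arbitrary witness over to its
  -- representative.
  any? : ∀ {p} {P : Pred Carrier p} → P Respects _≈_ → Decidable P → Dec (∃[ x ] P x)
  any? resp P? = map′
    (λ (i , Pi) → from i , Pi)
    (λ (x , Px) → to x , resp (sym (strictlyInverseʳ x)) Px)
    (Fin.any? (P? ∘ from))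

injection⇒≤ : ∀ {a b ℓ₁ ℓ₂ m n} {S : Setoid a ℓ₁} {T : Setoid b ℓ₂} →
              HasCardinality S m → HasCardinality T n → Injection S T → m ≤ n
injection⇒≤ S-finite T-finite f = Fin.injective⇒≤
  (Injection.injective (Inverse⇒Injection (Inverse-sym S-finite))
    ∘ Injection.injective f
    ∘ Injection.injective (Inverse⇒Injection T-finite))

-- Arithmetic in a finite field of odd order.

module FiniteField {c ℓ₁ ℓ₂ q} (F : HeytingField c ℓ₁ ℓ₂)
                   (finite : HasCardinality (HeytingField.setoid F) q) where

  open HeytingField F using (_#_; heytingCommutativeRing; tight; #⇒invertible; #-irrefl)
  open HeytingCommutativeRingProperties heytingCommutativeRing
    using (x-0≈x; 1#0)

  ring : CommutativeRing c ℓ₁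
  ring = record { isCommutativeRing = HeytingField.isCommutativeRing F }

  open CommutativeRing ring hiding (ring)
  open RingProperties (CommutativeRing.ring ring)
    using (-‿distribˡ-*; -‿distribʳ-*; x[y-z]≈xy-xz)
  open GroupProperties +-group
    using ( ⁻¹-involutive; inverseˡ-unique; x∙y⁻¹≈ε⇒x≈y; x≈y⇒x∙y⁻¹≈ε
          ; //-rightDividesʳ; //-rightDividesˡ)
  open Mult +-monoid using (×-assocˡ; ×-congʳ; ×-congˡ)
    renaming (_×_ to _·_)
  open Plane F using (_²; Point; planeSetoid; AtIntegralDistance; IntegralPointSet)
  open NaturalSolver commutativeSemiring using (solve; _:+_; _:*_; _:=_; con)
  open Finite setoid finite
  open Inverse finite
  open SetoidReasoning setoid

  to-injective : ∀ {x y} → to x ≡ to y → x ≈ y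
  to-injective = Injection.injective (Inverse⇒Injection finite)

  1≉0 : ¬ 1# ≈ 0#
  1≉0 1≈0 = #-irrefl 1≈0 1#0

  -- An inverse is sought among all elements, since `¬ x ≈ 0#` does not directly give `x # 0#`. If
  -- the search fails, then `x # 0#` is refuted, and tightness makes `x` zero.
  ≉0⇒inverse : ∀ {x} → ¬ x ≈ 0# → ∃[ y ] y * x ≈ 1#
  ≉0⇒inverse {x} x≉0 with any? (λ y≈z yx≈1 → trans (*-congʳ (sym y≈z)) yx≈1) (λ y → (y * x) ≟ 1#)
  ... | yes inv = inv
  ... | no ¬inv = contradiction (proj₁ (tight x 0#) ¬x#0) x≉0
    where
    ¬x#0 : ¬ x # 0#
    ¬x#0 x#0 with y , y[x-0]≈1 , _ ← #⇒invertible x#0 =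
      ¬inv (y , trans (*-congˡ (sym (x-0≈x x))) y[x-0]≈1)

  xy≈0⇒y≈0 : ∀ {x y} → ¬ x ≈ 0# → x * y ≈ 0# → y ≈ 0#
  xy≈0⇒y≈0 {x} {y} x≉0 xy≈0 with x⁻¹ , x⁻¹x≈1 ← ≉0⇒inverse x≉0 = begin
    y              ≈⟨ *-identityˡ y ⟨
    1# * y         ≈⟨ *-congʳ x⁻¹x≈1 ⟨
    x⁻¹ * x * y    ≈⟨ *-assoc x⁻¹ x y ⟩
    x⁻¹ * (x * y)  ≈⟨ *-congˡ xy≈0 ⟩
    x⁻¹ * 0#       ≈⟨ zeroʳ x⁻¹ ⟩
    0#             ∎

  x²≈0⇒x≈0 : ∀ {x} → x ² ≈ 0# → x ≈ 0#
  x²≈0⇒x≈0 {x} x²≈0 with x ≟ 0#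
  ... | yes x≈0 = x≈0
  ... | no  x≉0 = xy≈0⇒y≈0 x≉0 x²≈0

  -- Translation by x permutes the field, so ∑ y = ∑ (y + x) = ∑ y + q · x.
  q·x≈0 : ∀ x → q · x ≈ 0#
  q·x≈0 x = begin
    q · x                ≈⟨ sum-replicate q ⟨
    ∑x                   ≈⟨ //-rightDividesʳ ∑y ∑x ⟨
    ∑x + ∑y - ∑y         ≈⟨ +-congʳ (trans (+-comm ∑x ∑y) ∑y+∑x≈∑y) ⟩
    ∑y - ∑y              ≈⟨ -‿inverseʳ ∑y ⟩
    0#                   ∎
    where
    open Sum +-commutativeMonoid

    ∑x = ∑[ i < q ] x
    ∑y = ∑[ i < q ] from i

    translation : Permutation.Permutation q q
    translation = Permutation.permutation
      (λ i → to (from i + x)) (λ i → to (from i - x))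
      (λ i → inverseˡ (trans (+-congʳ (strictlyInverseʳ _)) (//-rightDividesˡ x (from i))))
      (λ i → inverseˡ (trans (+-congʳ (strictlyInverseʳ _)) (//-rightDividesʳ x (from i))))

    ∑y+∑x≈∑y : ∑y + ∑x ≈ ∑y
    ∑y+∑x≈∑y = begin
      ∑y + ∑x                            ≈⟨ ∑-distrib-+ from (λ _ → x) ⟨
      ∑[ i < q ] (from i + x)            ≈⟨ sum-cong-≋ {q} (λ i → sym (strictlyInverseʳ _)) ⟩
      ∑[ i < q ] from (to (from i + x))  ≈⟨ ∑-permute from translation ⟨
      ∑y                                 ∎

  -- If 2 vanished, an odd number of copies of `1#` would sum to `1#`, whereas `q` copies sum to
  -- `0#`.
  2≉0 : 2 ∤ q → ¬ 1# + 1# ≈ 0#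
  2≉0 2∤q 2≈0 with m , q≡1+m*2 ← 2∤n⇒n≡1+m*2 2∤q = 1≉0 (begin
    1#                    ≈⟨ +-identityʳ 1# ⟨
    1# + 0#               ≈⟨ +-congˡ (m·0≈0 m) ⟨
    1# + m · 0#           ≈⟨ +-congˡ (×-congʳ m (trans (+-congˡ (+-identityʳ 1#)) 2≈0)) ⟨
    1# + m · (2 · 1#)     ≈⟨ +-congˡ (×-assocˡ 1# m 2) ⟩
    suc (m ℕ.* 2) · 1#    ≈⟨ ×-congˡ q≡1+m*2 ⟨
    q · 1#                ≈⟨ q·x≈0 1# ⟩
    0#                    ∎)
    where
    m·0≈0 : ∀ m → m · 0# ≈ 0#
    m·0≈0 zero    = refl
    m·0≈0 (suc m) = trans (+-identityˡ _) (m·0≈0 m)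

  -- Squares, and a sum of two squares that is not a square.

  ²-cong : ∀ {x y} → x ≈ y → x ² ≈ y ²
  ²-cong x≈y = *-cong x≈y x≈y

  [-x]²≈x² : ∀ x → (- x) ² ≈ x ²
  [-x]²≈x² x = begin
    - x * - x      ≈⟨ -‿distribˡ-* x (- x) ⟨
    - (x * - x)    ≈⟨ -‿cong (-‿distribʳ-* x x) ⟨
    - (- (x * x))  ≈⟨ ⁻¹-involutive (x * x) ⟩
    x * x          ∎

  Square : Pred Carrier _
  Square x = ∃[ t ] x ≈ t ²

  square-resp : Square Respects _≈_
  square-resp x≈y (t , x≈t²) = t , trans (sym x≈y) x≈t²

  square? : Decidable Square
  square? x = any? (λ t≈u x≈t² → trans x≈t² (²-cong t≈u)) (λ t → x ≟ (t ²))

  -- A square root function on all of the field misses minus the root of 1, so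
  -- that adjoining this value would inject q + 1 elements into q.
  ¬all-square : 2 ∤ q → ¬ (∀ x → Square x)
  ¬all-square 2∤q root = 1+n≰n (Fin.injective⇒≤ extended-injective)
    where
    -- Roots are taken on indices because `root` may choose different roots for elements that are
    -- merely `≈`-equal.
    √ : Fin q → Carrier
    √ i = proj₁ (root (from i))

    √²≈ : ∀ i → √ i ² ≈ from i
    √²≈ i = sym (proj₂ (root (from i)))

    e : Carrier
    e = √ (to 1#)

    e²≈1 : e ² ≈ 1#
    e²≈1 = trans (√²≈ (to 1#)) (strictlyInverseʳ 1#)

    -e≉√ : ∀ i → ¬ - e ≈ √ i
    -e≉√ i -e≈√i = 1≉0 (begin
      1#      ≈⟨ e²≈1 ⟨
      e ²     ≈⟨ *-congʳ e≈0 ⟩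
      0# * e  ≈⟨ zeroˡ e ⟩
      0#      ∎)
      where
      -- Squaring `- e ≈ √ i` identifies `i` as the index of `1#`. Hence `√ i` is `e` itself, and
      -- `- e ≈ e` forces `e` to vanish.
      1≡i : to 1# ≡ i
      1≡i = inverseˡ (begin
        1#       ≈⟨ e²≈1 ⟨
        e ²      ≈⟨ [-x]²≈x² e ⟨
        (- e) ²  ≈⟨ ²-cong -e≈√i ⟩
        √ i ²    ≈⟨ √²≈ i ⟩
        from i   ∎)

      e≈0 : e ≈ 0#
      e≈0 = xy≈0⇒y≈0 (2≉0 2∤q) (begin
        (1# + 1#) * e    ≈⟨ distribʳ e 1# 1# ⟩
        1# * e + 1# * e  ≈⟨ +-cong (*-identityˡ e) (*-identityˡ e) ⟩
        e + e            ≈⟨ +-congˡ (reflexive (≡.cong √ 1≡i)) ⟩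
        e + √ i          ≈⟨ +-congˡ -e≈√i ⟨
        e - e            ≈⟨ -‿inverseʳ e ⟩
        0#               ∎)

    extended : Fin (suc q) → Fin q
    extended zero    = to (- e)
    extended (suc i) = to (√ i)

    extended-injective : Injective _≡_ _≡_ extended
    extended-injective {zero}  {zero}  _  = ≡.refl
    extended-injective {zero}  {suc j} eq = contradiction (to-injective eq) (-e≉√ j)
    extended-injective {suc i} {zero}  eq = contradiction (sym (to-injective eq)) (-e≉√ i)
    extended-injective {suc i} {suc j} eq = ≡.cong suc
      (≡.trans (≡.sym (strictlyInverseˡ i)) (inverseˡ (begin
        from i   ≈⟨ √²≈ i ⟨
        √ i ²    ≈⟨ ²-cong (to-injective eq) ⟩
        √ j ²    ≈⟨ √²≈ j ⟩
        from j   ∎)))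

  module _ (square-+ : ∀ a b → Square (a ² + b ²)) where

    square-· : ∀ n a → Square (n · (a ²))
    square-· zero    a = 0# , sym (zeroˡ 0#)
    square-· (suc n) a with t , n·a²≈t² ← square-· n a =
      square-resp (+-congˡ (sym n·a²≈t²)) (square-+ a t)

    square-neg : ∀ a → Square (- (a ²))
    -- The index `to 0#` shows that `q` is positive, so that `ℕ.pred q` really is `q` minus one.
    square-neg a = square-resp (pred·≈- (to 0#) (q·x≈0 (a ²))) (square-· (ℕ.pred q) a)
      where
      pred·≈- : ∀ {n x} → Fin n → n · x ≈ 0# → ℕ.pred n · x ≈ - x
      pred·≈- {suc n} _ eq = inverseˡ-unique _ _ (trans (+-comm _ _) eq)

    all-square : 2 ∤ q → ∀ z → Square z
    all-square 2∤q z with h , 2⁻¹ ← ≉0⇒inverse (2≉0 2∤q) = square-resp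
      (begin
        (x + 1#) ² + t ²
          ≈⟨ +-cong (solve 1 (λ x → (x :+ con 1) :* (x :+ con 1) :=
                       (con 2 :* x :+ con 1) :+ x :* x) refl x)
                    (sym -x²≈t²) ⟩
        ((1# + 1#) * x + 1#) + x ² - x ²  ≈⟨ //-rightDividesʳ (x ²) _ ⟩
        (1# + 1#) * x + 1#                ≈⟨ +-congʳ 2x≈z-1 ⟩
        z - 1# + 1#                       ≈⟨ //-rightDividesˡ 1# z ⟩
        z                                 ∎)
      (square-+ (x + 1#) t)
      where
      -- Here `h` is the inverse of 2, so this is the solution of `z = 2x + 1`.
      x = h * (z - 1#)
      t = proj₁ (square-neg x)
      -x²≈t² = proj₂ (square-neg x)

      2x≈z-1 : (1# + 1#) * x ≈ z - 1#
      2x≈z-1 = begin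
        (1# + 1#) * (h * (z - 1#))  ≈⟨ *-assoc _ h _ ⟨
        (1# + 1#) * h * (z - 1#)    ≈⟨ *-congʳ (trans (*-comm _ h) 2⁻¹) ⟩
        1# * (z - 1#)               ≈⟨ *-identityˡ _ ⟩
        z - 1#                      ∎

  -- Being a square is decidable, so a search over all pairs turns the mere contradiction into an
  -- explicit `a` and `b`.
  ∃-nonsquare-sum : 2 ∤ q → ∃[ a ] ∃[ b ] ¬ Square (a ² + b ²)
  ∃-nonsquare-sum 2∤q with any? respˡ (λ a → any? (respʳ a) λ b → ¬? (square? (a ² + b ²)))
    where
    respʳ : ∀ a → (λ b → ¬ Square (a ² + b ²)) Respects _≈_
    respʳ a b≈c ¬sq sq = ¬sq (square-resp (+-congˡ (²-cong (sym b≈c))) sq)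
    respˡ : (λ a → ∃[ b ] ¬ Square (a ² + b ²)) Respects _≈_
    respˡ a≈c (b , ¬sq) = b , λ sq → ¬sq (square-resp (+-congʳ (²-cong (sym a≈c))) sq)
  ... | yes found = found
  ... | no  none  = contradiction (all-square square-+ 2∤q) (¬all-square 2∤q)
    where
    square-+ : ∀ a b → Square (a ² + b ²)
    square-+ a b = decidable-stable (square? _) λ ¬sq → none (a , b , ¬sq)

  -- Upper bound: one point on each parallel line.

  nonsquare-scaling : ∀ {n s t} → ¬ Square n → n * t ² ≈ s ² → s ≈ 0#
  nonsquare-scaling {n} {s} {t} ¬sq nt²≈s² with t ≟ 0#
  ... | yes t≈0 = x²≈0⇒x≈0 (begin
    s ²           ≈⟨ nt²≈s² ⟨
    n * t ²       ≈⟨ *-congˡ (trans (*-congʳ t≈0) (zeroˡ t)) ⟩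
    n * 0#        ≈⟨ zeroʳ n ⟩
    0#            ∎)
  -- Dividing by `t ²` would exhibit `n` as the square of `u * s`.
  ... | no  t≉0 with u , ut≈1 ← ≉0⇒inverse t≉0 = contradiction (u * s , (begin
    n                      ≈⟨ *-identityʳ n ⟨
    n * 1#                 ≈⟨ *-congˡ (trans (²-cong ut≈1) (*-identityˡ 1#)) ⟨
    n * (u * t) ²          ≈⟨ solve 3 (λ n u t → n :* ((u :* t) :* (u :* t)) :=
                                u :* u :* (n :* (t :* t))) refl n u t ⟩
    u * u * (n * t ²)      ≈⟨ *-congˡ nt²≈s² ⟩
    u * u * s ²            ≈⟨ solve 2 (λ u s → u :* u :* (s :* s) :=
                                (u :* s) :* (u :* s)) refl u s ⟩
    (u * s) ²              ∎)) ¬sq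

  w-x≈y-z⇒w-y≈x-z : ∀ {w x y z} → w - x ≈ y - z → w - y ≈ x - z
  w-x≈y-z⇒w-y≈x-z {w} {x} {y} {z} w-x≈y-z = begin
    w - y              ≈⟨ +-congʳ (//-rightDividesˡ x w) ⟨
    w - x + x - y      ≈⟨ +-congʳ (+-congʳ w-x≈y-z) ⟩
    y - z + x - y      ≈⟨ solve 4 (λ w x y z → w :+ x :+ y :+ z := y :+ x :+ w :+ z)
                            refl y (- z) x (- y) ⟩
    x - z + y - y      ≈⟨ //-rightDividesʳ y (x - z) ⟩
    x - z              ∎

  -- The cross product with `(a , b)`, which is constant on each line of that direction.
  offset : Carrier → Carrier → Point → Carrier
  offset a b (x , y) = a * y - b * x

  offset-cong : ∀ a b {u v} → Setoid._≈_ planeSetoid u v → offset a b u ≈ offset a b v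
  offset-cong a b (u₁≈v₁ , u₂≈v₂) = +-cong (*-congˡ u₂≈v₂) (-‿cong (*-congˡ u₁≈v₁))

  module _ (a b : Carrier) (¬sq : ¬ Square (a ² + b ²)) where

    -- The inner product `s` stands in for the factor of proportionality between `(x , y)` and
    -- `(a , b)`, which avoids asking which of `a` and `b` is nonzero. From `n * x ≈ a * s` and
    -- `n * y ≈ b * s` follows `n * t ² ≈ s ²`; as `n` is not a square, `s` vanishes, and then so do
    -- `x` and `y`.
    parallel-integral⇒≈0 : ∀ {x y} → a * y ≈ b * x → Square (x ² + y ²) → x ≈ 0# × y ≈ 0#
    parallel-integral⇒≈0 {x} {y} ay≈bx (t , d≈t²) =
      xy≈0⇒y≈0 n≉0 (trans nx≈as (vanish a)) , xy≈0⇒y≈0 n≉0 (trans ny≈bs (vanish b))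
      where
      n = a ² + b ²
      s = a * x + b * y

      n≉0 : ¬ n ≈ 0#
      -- Zero is a square, so a nonsquare is invertible.
      n≉0 n≈0 = ¬sq (0# , trans n≈0 (sym (zeroˡ 0#)))

      nx≈as : n * x ≈ a * s
      nx≈as = begin
        n * x                      ≈⟨ solve 3 (λ a b x → (a :* a :+ b :* b) :* x :=
                                        a :* (a :* x) :+ b :* (b :* x)) refl a b x ⟩
        a * (a * x) + b * (b * x)  ≈⟨ +-congˡ (*-congˡ ay≈bx) ⟨
        a * (a * x) + b * (a * y)  ≈⟨ solve 4 (λ a b x y → a :* (a :* x) :+ b :* (a :* y) :=
                                        a :* (a :* x :+ b :* y)) refl a b x y ⟩
        a * s                      ∎

      ny≈bs : n * y ≈ b * s
      ny≈bs = begin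
        n * y                      ≈⟨ solve 3 (λ a b y → (a :* a :+ b :* b) :* y :=
                                        a :* (a :* y) :+ b :* (b :* y)) refl a b y ⟩
        a * (a * y) + b * (b * y)  ≈⟨ +-congʳ (*-congˡ ay≈bx) ⟩
        a * (b * x) + b * (b * y)  ≈⟨ solve 4 (λ a b x y → a :* (b :* x) :+ b :* (b :* y) :=
                                        b :* (a :* x :+ b :* y)) refl a b x y ⟩
        b * s                      ∎

      s≈0 : s ≈ 0#
      s≈0 = nonsquare-scaling ¬sq (begin
        n * t ²                    ≈⟨ *-congˡ d≈t² ⟨
        n * (x ² + y ²)            ≈⟨ solve 3 (λ n x y → n :* (x :* x :+ y :* y) :=
                                        n :* x :* x :+ n :* y :* y) refl n x y ⟩
        n * x * x + n * y * y      ≈⟨ +-cong (*-congʳ nx≈as) (*-congʳ ny≈bs) ⟩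
        a * s * x + b * s * y      ≈⟨ solve 5 (λ a b x y s → a :* s :* x :+ b :* s :* y :=
                                        s :* (a :* x :+ b :* y)) refl a b x y s ⟩
        s ²                        ∎)

      vanish : ∀ c → c * s ≈ 0#
      vanish c = trans (*-congˡ s≈0) (zeroʳ c)

    offset-injective : ∀ {u v} → AtIntegralDistance u v → offset a b u ≈ offset a b v →
                       Setoid._≈_ planeSetoid u v
    offset-injective {u₁ , u₂} {v₁ , v₂} integral eq =
      x∙y⁻¹≈ε⇒x≈y u₁ v₁ (proj₁ u-v≈0) , x∙y⁻¹≈ε⇒x≈y u₂ v₂ (proj₂ u-v≈0)
      where
      u-v≈0 : u₁ - v₁ ≈ 0# × u₂ - v₂ ≈ 0#
      u-v≈0 = parallel-integral⇒≈0 (begin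
        a * (u₂ - v₂)      ≈⟨ x[y-z]≈xy-xz a u₂ v₂ ⟩
        a * u₂ - a * v₂    ≈⟨ w-x≈y-z⇒w-y≈x-z eq ⟩
        b * u₁ - b * v₁    ≈⟨ x[y-z]≈xy-xz b u₁ v₁ ⟨
        b * (u₁ - v₁)      ∎) integral

  -- The offset maps the point set injectively into the field, which has `q` elements.
  upperBound : 2 ∤ q → ∀ {ℓ} n → Plane.IntegralCardinality F ℓ n → n ≤ q
  upperBound 2∤q n (A , A-finite) with a , b , ¬sq ← ∃-nonsquare-sum 2∤q =
    injection⇒≤ A-finite finite (record
      { to        = λ (u , _) → offset a b u
      ; cong      = λ {(u , _)} {(v , _)} → offset-cong a b {u} {v}
      ; injective = λ {(u , u∈A)} {(v , v∈A)} →
                    offset-injective a b ¬sq {u} {v} (integral u∈A v∈A)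
      })
    where open IntegralPointSet A

  -- Lower bound: the x-axis.

  -- Membership compares indices rather than field elements, in order that it
  -- can be lifted to an arbitrary level.
  xAxis : ∀ ℓ → IntegralPointSet ℓ
  xAxis ℓ = record
    { points   = λ (x , y) → Lift ℓ (to y ≡ to 0#)
    ; respects = λ (_ , y≈z) (lift y≡0) → lift (≡.trans (to-cong (sym y≈z)) y≡0)
    ; integral = λ { {x , y} {x′ , y′} (lift y≡0) (lift y′≡0) →
        x - x′ , (begin
          (x - x′) ² + (y - y′) ²
            ≈⟨ +-congˡ (²-cong (x≈y⇒x∙y⁻¹≈ε (to-injective (≡.trans y≡0 (≡.sym y′≡0))))) ⟩
          (x - x′) ² + 0# ²         ≈⟨ +-congˡ (zeroˡ 0#) ⟩
          (x - x′) ² + 0#           ≈⟨ +-identityʳ _ ⟩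
          (x - x′) ²                ∎) }
    }

  xAxis-cardinality : ∀ ℓ → Plane.IntegralCardinality F ℓ q
  xAxis-cardinality ℓ = xAxis ℓ , record
    { to        = λ ((x , _) , _) → to x
    ; from      = λ i → (from i , 0#) , lift ≡.refl
    ; to-cong   = λ (x≈x′ , _) → to-cong x≈x′
    ; from-cong = λ i≡j → from-cong i≡j , refl
    ; inverse   = (λ (x≈ , _) → inverseˡ x≈)
                , λ { {(_ , y) , lift y≡0} i≡ →
                      inverseʳ i≡ , sym (to-injective y≡0) }
    }

theorem7 : {c ℓ₁ ℓ₂ ℓ : Level} (p r q : ℕ) → Prime p → p ≢ 2 → r ≥ 1 → q ≡ p ^ r →
    (F : HeytingField c ℓ₁ ℓ₂) → HasCardinality (HeytingField.setoid F) q →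
    MaximumIntegralCardinality F ℓ q
theorem7 {ℓ = ℓ} p r q pr p≢2 _ ≡.refl F finite =
  xAxis-cardinality ℓ , upperBound (2∤p^r r pr p≢2)
  where open FiniteField F finite
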